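{- Let $p$ be a propositional variable. (1) The frame property $\forall x\forall y\forall z(xRy\land yRz\land x\neq y\land y\neq z\land x\neq z\to xRz)$ is defined by the formula $\circ p\land p\to\circ(\circ p\land p)$; that is, for every frame $\mathcal{F}$, $\mathcal{F}$ has this property if and only if $\mathcal{F}\vDash\circ p\land p\to\circ(\circ p\land p)$. (2) The frame property $\forall x\forall y\forall z(xRy\land xRz\land x\neq y\land x\neq z\land y\neq z\to yRz)$ is defined by the formula $\neg\circ\neg p\to\circ(\circ\neg p\to p)$; that is, for every frame $\mathcal{F}$, $\mathcal{F}$ has this property if and only if $\mathcal{F}\vDash\neg\circ\neg p\to\circ(\circ\neg p\to p)$.
   Context: Let $\mathbf{P}$ be a set of propositional variables with $p\in\mathbf{P}$. The language $\mathcal{L}(\circ)$ is given by $\phi::=q\mid\neg\phi\mid(\phi\land\phi)\mid\circ\phi$ with $q\in\mathbf{P}$; other Boolean connectives are the usual abbreviations; $\circ$ and $\neg$ bind more strongly than $\land$, which binds more strongly than $\to$. A frame is $\mathcal{F}=\langle S,R\rangle$ with $S$ a nonempty set and $R\subseteq S\times S$; a model based on $\mathcal{F}$ is $\mathcal{M}=\langle S,R,V\rangle$ with $V:\mathbf{P}\to\mathcal{P}(S)$. Satisfaction: $\mathcal{M},s\vDash q$ iff $s\in V(q)$; Booleans as usual; $\mathcal{M},s\vDash\circ\phi$ iff ($\mathcal{M},s\vDash\phi$ implies that $\mathcal{M},t\vDash\phi$ for all $t$ with $sRt$). $\mathcal{F}\vDash\phi$ means $\mathcal{M},s\vDash\phi$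 for every model $\mathcal{M}$ based on $\mathcal{F}$ and every $s\in S$. -}

module Defs where

open import Data.Product using (_×_)
open import Function.Bundles using (_⇔_)
open import Level using (Level; _⊔_; suc)
open import Relation.Binary.Core using (Rel)
open import Relation.Binary.PropositionalEquality using (_≢_)
open import Relation.Nullary using (¬_)
open import Relation.Unary using (Pred)

private
  variable
    p ℓ : Level

infix  9 ∘_ ~_
infixr 7 _∧_
infixr 6 _⇒_
infix  4 _,_⊨_ _⊩_ _Defines_

data Formula (P : Set p) : Set p where
  var : P → Formula P
  ~_  : Formula P → Formula P
  _∧_ : Formula P → Formula P → Formula P
  ∘_  : Formula P → Formula P

-- An abbreviation in the classical language, so it is interpreted as
-- ¬ (φ × ¬ ψ); this agrees with the function space under excluded middle.
_⇒_ : {P : Set p} → Formula P → Formula P → Formula P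
φ ⇒ ψ = ~ (φ ∧ ~ ψ)

-- Worlds, accessibility and valuations share one universe level, so that
-- satisfaction of a variable needs no lifting.
record Frame (ℓ : Level) : Set (suc ℓ) where
  field
    S        : Set ℓ
    R        : Rel S ℓ
    nonempty : S

record Model (P : Set p) (ℓ : Level) : Set (p ⊔ suc ℓ) where
  constructor model
  field
    frame : Frame ℓ
  open Frame frame public
  field
    V : P → Pred S ℓ

_,_⊨_ : {P : Set p} (M : Model P ℓ) → Model.S M → Formula P → Set ℓ
M , s ⊨ var q   = Model.V M q s
M , s ⊨ ~ φ     = ¬ (M , s ⊨ φ)
M , s ⊨ (φ ∧ ψ) = (M , s ⊨ φ) × (M , s ⊨ ψ)
M , s ⊨ ∘ φ     = M , s ⊨ φ → ∀ t → Model.R M s t → M , t ⊨ φ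

-- Validity on a frame: truth at every state under every valuation.
_⊩_ : {P : Set p} → Frame ℓ → Formula P → Set (p ⊔ suc ℓ)
_⊩_ {ℓ = ℓ} {P = P} F φ =
  (V : P → Pred (Frame.S F) ℓ) (s : Frame.S F) → model F V , s ⊨ φ

_Defines_ : {P : Set p} → Formula P → (Frame ℓ → Set ℓ) → Set (p ⊔ suc ℓ)
φ Defines C = ∀ F → C F ⇔ F ⊩ φ

DistinctTransitive : Frame ℓ → Set ℓ
DistinctTransitive F = ∀ x y z →
  R x y → R y z → x ≢ y → y ≢ z → x ≢ z → R x z
  where open Frame F

DistinctEuclidean : Frame ℓ → Set ℓ
DistinctEuclidean F = ∀ x y z →
  R x y → R x z → x ≢ y → x ≢ z → y ≢ z → R y z
  where open Frame F

-- For the converse directions, each formula is evaluated at x: in (1) under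
-- V(p) = {x} ∪ R[x], where validity forces V(p) to be closed under two steps
-- from x; in (2) under V(p) = {z}, where it forces y to see z.

module Submission where

open import Axiom.DoubleNegationElimination using (em⇒dne)
open import Axiom.ExcludedMiddle using (ExcludedMiddle)
open import Data.Product using (_×_; _,_; proj₁)
open import Data.Sum using (_⊎_; inj₁; inj₂; fromInj₂)
open import Function.Base using (_∘′_)
open import Function.Bundles using (mk⇔)
open import Level using (Level)
open import Relation.Binary.PropositionalEquality using (_≡_; refl; sym)
open import Relation.Nullary using (yes; no; contradiction)
open import Defs

private
  variable
    a ℓ : Level
    P : Set a

transitive⇒valid : ExcludedMiddle ℓ → (p : P) (F : Frame ℓ) →
  DistinctTransitive F → F ⊩ (∘ var p ∧ var p ⇒ ∘ (∘ var p ∧ var p))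
transitive⇒valid em p F trans V s ((box , ps) , ¬ψ) =
  ¬ψ λ _ t sRt → (λ pt u tRu → two-steps t u sRt tRu pt) , box ps t sRt
  where
  open Frame F
  -- If the three points are distinct or `s ≡ t`, then `u` is a successor of `s` and `box` applies;
  -- otherwise `u` is `t` or `s`, where `p` is already known.
  two-steps : ∀ t u → R s t → R t u → V p t → V p u
  two-steps t u sRt tRu pt with em {s ≡ t} | em {t ≡ u} | em {s ≡ u}
  ... | yes refl | _        | _        = box ps u tRu
  ... | no _     | yes refl | _        = pt
  ... | no _     | no _     | yes refl = ps
  ... | no s≢t   | no t≢u   | no s≢u   =
    box ps u (trans s t u sRt tRu s≢t t≢u s≢u)

valid⇒transitive : ExcludedMiddle ℓ → (p : P) (F : Frame ℓ) →
  F ⊩ (∘ var p ∧ var p ⇒ ∘ (∘ var p ∧ var p)) → DistinctTransitive F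
valid⇒transitive em p F valid x y z xRy yRz _ _ x≢z =
  -- As `⇒` is built from negations, validity gives `V p z` only doubly negated.
  fromInj₂ (λ z≡x → contradiction (sym z≡x) x≢z) (em⇒dne em λ ¬pz →
    valid V x (φ , λ ψ → ¬pz (proj₁ (ψ φ y xRy) (inj₂ xRy) z yRz)))
  where
  open Frame F
  -- The least extension of `p` for which `∘ var p ∧ var p` holds at `x`.
  V = λ _ w → w ≡ x ⊎ R x w
  φ : model F V , x ⊨ (∘ var p ∧ var p)
  φ = (λ _ _ → inj₂) , inj₁ refl

-- A successor `t` of `s` violating the inner implication satisfies `∘ ~ var p` and `~ var p`. This
-- forces `∘ ~ var p` at `s`, contrary to the premise.
euclidean⇒valid : ExcludedMiddle ℓ → (p : P) (F : Frame ℓ) →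
  DistinctEuclidean F → F ⊩ (~ ∘ ~ var p ⇒ ∘ (∘ ~ var p ⇒ var p))
euclidean⇒valid em p F eucl V s (¬box , ¬ψ) =
  ¬ψ λ _ t sRt (boxt , ¬pt) → ¬box λ ¬ps u sRu pu →
    siblings t u sRt sRu boxt ¬pt ¬ps pu
  where
  open Frame F
  siblings : ∀ t u → R s t → R s u → model F V , t ⊨ ∘ ~ var p →
    model F V , t ⊨ ~ var p → model F V , s ⊨ ~ var p →
    model F V , u ⊨ ~ var p
  siblings t u sRt sRu boxt ¬pt ¬ps pu
    with em {s ≡ t} | em {t ≡ u} | em {s ≡ u}
  ... | yes refl | _        | _        = boxt ¬pt u sRu pu
  ... | no _     | yes refl | _        = ¬pt pu
  ... | no _     | no _     | yes refl = ¬ps pu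
  ... | no s≢t   | no t≢u   | no s≢u   =
    boxt ¬pt u (eucl s t u sRt sRu s≢t s≢u t≢u) pu

valid⇒euclidean : ExcludedMiddle ℓ → (p : P) (F : Frame ℓ) →
  F ⊩ (~ ∘ ~ var p ⇒ ∘ (∘ ~ var p ⇒ var p)) → DistinctEuclidean F
valid⇒euclidean em p F valid x y z xRy xRz _ x≢z y≢z = em⇒dne em λ ¬yRz →
  valid V x (¬box , λ ψ →
    -- The outer `∘` first demands the inner implication at `x`, which holds because its premise
    -- fails there. At `y` it is refuted: without `R y z`, neither `y` nor any successor of `y`
    -- equals `z`.
    ψ (¬box ∘′ proj₁) y xRy ((λ { _ t yRt refl → ¬yRz yRt }) , y≢z))
  where
  open Frame F
  V = λ _ w → w ≡ z
  ¬box : model F V , x ⊨ ~ ∘ ~ var p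
  ¬box box = box x≢z z xRz refl

proposition12 : ∀ {a ℓ : Level} → ExcludedMiddle ℓ → {P : Set a} (p : P) →
    ((∘ var p ∧ var p ⇒ ∘ (∘ var p ∧ var p)) Defines DistinctTransitive {ℓ}) ×
    ((~ ∘ ~ var p ⇒ ∘ (∘ ~ var p ⇒ var p)) Defines DistinctEuclidean {ℓ})
proposition12 em p =
  (λ F → mk⇔ (transitive⇒valid em p F) (valid⇒transitive em p F)) ,
  (λ F → mk⇔ (euclidean⇒valid em p F) (valid⇒euclidean em p F))
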